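{- Let $m,n\ge 1$. (I) Let $R=(r_1,\dots,r_m)$ and $S=(s_1,\dots,s_n)$ be vectors of nonnegative real numbers with $\sum_i r_i=\sum_j s_j$. Then $\mathcal{T}^{\infty}(R,S)\neq\emptyset$ if and only if (a) $S$ is palindromic, i.e. $s_j=s_{n+1-j}$ for all $j$. (II) Suppose in addition that $R$ and $S$ have nonnegative integer components. Then $\mathcal{T}^{\infty}_{\mathbb{Z}}(R,S)\neq\emptyset$ if and only if (a) holds and (b) if $n$ is even then every component of $R$ is even, and if $n$ is odd then $s_{\lceil n/2\rceil}\ge o(R)$, where $o(R)$ is the number of odd components of $R$.
   Context: $\mathcal{T}(R,S)$ is the set of $m\times n$ matrices with nonnegative real entries whose $i$th row sum is $r_i$ and whose $j$th column sum is $s_j$ for all $i,j$. The reflection $r_\infty$ (in a vertical line) acts on $m\times n$ matrices by $(r_\infty A)_{i,j}=a_{i,\,n+1-j}$. $\mathcal{T}^{\infty}(R,S)$ is the set of $A\in\mathcal{T}(R,S)$ with $r_\infty A=A$; $\mathcal{T}^{\infty}_{\mathbb{Z}}(R,S)$ is the set of those $A\in\mathcal{T}^{\infty}(R,S)$ all of whose entries are integers. -}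

module Defs where

open import Algebra.Bundles.Raw using (RawMonoid)
import Algebra.Definitions.RawMonoid as Sum
open import Data.Fin.Base using (Fin; fromℕ<)
open import Data.Integer.Base as ℤ using (ℤ)
open import Data.Nat.Base as ℕ using (ℕ; suc; s≤s; ⌈_/2⌉; _∸_; NonZero)
open import Data.Nat.Divisibility using (_∣_; _∣?_)
import Data.Nat.Properties as ℕ
open import Data.Product.Base using (∃-syntax; _×_; _,_)
open import Data.Rational.Base as ℚ using (ℚ; 0ℚ; ½; ∣_∣)
import Data.Rational.Properties as ℚ
open import Data.Rational.Solver using (module +-*-Solver)
open import Data.Vec.Base using (count; tabulate)
open import Data.Vec.Functional using (Vector; reverse; transpose)
open import Level using (0ℓ)
open import Relation.Binary.Core using (Rel)
open import Relation.Binary.PropositionalEquality using (_≡_; refl; sym; subst; cong)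
open import Relation.Nullary.Decidable using (¬?)
open import Relation.Nullary.Negation using (¬_)
open import Relation.Unary using (Pred; _∈_)

-- Real numbers are Cauchy sequences of rationals; their equality is _≃_,
-- not _≡_.

IsCauchy : Pred (ℕ → ℚ) 0ℓ
IsCauchy x = ∀ ε → 0ℚ ℚ.< ε →
  ∃[ N ] (∀ k l → N ℕ.≤ k → N ℕ.≤ l → ∣ x k ℚ.- x l ∣ ℚ.< ε)

record ℝ : Set where
  constructor mkℝ
  field
    seq    : ℕ → ℚ
    cauchy : IsCauchy seq

open ℝ public

infix 4 _≃_ _≤_

record _≃_ (x y : ℝ) : Set where
  constructor mk≃
  field
    close : ∀ ε → 0ℚ ℚ.< ε →
      ∃[ N ] (∀ k → N ℕ.≤ k → ∣ seq x k ℚ.- seq y k ∣ ℚ.< ε)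

-- The slack ε is needed: the terms of x may exceed those of y by a
-- null sequence.
record _≤_ (x y : ℝ) : Set where
  constructor mk≤
  field
    below : ∀ ε → 0ℚ ℚ.< ε →
      ∃[ N ] (∀ k → N ℕ.≤ k → seq x k ℚ.< seq y k ℚ.+ ε)

private
  rearrange : ∀ a b c d → (a ℚ.+ b) ℚ.- (c ℚ.+ d) ≡ (a ℚ.- c) ℚ.+ (b ℚ.- d)
  rearrange = solve 4 (λ a b c d → (a :+ b) :- (c :+ d) := (a :- c) :+ (b :- d)) refl
    where open +-*-Solver

  halves : ∀ ε → ½ ℚ.* ε ℚ.+ ½ ℚ.* ε ≡ ε
  halves = solve 1 (λ ε → con ½ :* ε :+ con ½ :* ε := ε) refl
    where open +-*-Solver

  half-pos : ∀ {ε} → 0ℚ ℚ.< ε → 0ℚ ℚ.< ½ ℚ.* ε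
  half-pos = ℚ.*-monoʳ-<-pos ½

  +-cauchy : ∀ x y → IsCauchy x → IsCauchy y → IsCauchy (λ k → x k ℚ.+ y k)
  +-cauchy x y cx cy ε 0<ε with cx (½ ℚ.* ε) (half-pos 0<ε) | cy (½ ℚ.* ε) (half-pos 0<ε)
  ... | M , p | N , q = M ℕ.⊔ N , λ k l M⊔N≤k M⊔N≤l → begin-strict
    ∣ (x k ℚ.+ y k) ℚ.- (x l ℚ.+ y l) ∣
      ≡⟨ cong ∣_∣ (rearrange (x k) (y k) (x l) (y l)) ⟩
    ∣ (x k ℚ.- x l) ℚ.+ (y k ℚ.- y l) ∣
      ≤⟨ ℚ.∣p+q∣≤∣p∣+∣q∣ (x k ℚ.- x l) (y k ℚ.- y l) ⟩
    ∣ x k ℚ.- x l ∣ ℚ.+ ∣ y k ℚ.- y l ∣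
      <⟨ ℚ.+-mono-< (p k l (ℕ.m⊔n≤o⇒m≤o M N M⊔N≤k) (ℕ.m⊔n≤o⇒m≤o M N M⊔N≤l))
                    (q k l (ℕ.m⊔n≤o⇒n≤o M N M⊔N≤k) (ℕ.m⊔n≤o⇒n≤o M N M⊔N≤l)) ⟩
    ½ ℚ.* ε ℚ.+ ½ ℚ.* ε
      ≡⟨ halves ε ⟩
    ε ∎
    where open ℚ.≤-Reasoning

infixl 6 _+_

_+_ : ℝ → ℝ → ℝ
x + y = mkℝ (λ k → seq x k ℚ.+ seq y k)
            (+-cauchy (seq x) (seq y) (cauchy x) (cauchy y))

fromℚ : ℚ → ℝ
fromℚ p = mkℝ (λ _ → p) λ ε 0<ε →
  0 , λ _ _ _ _ → subst (λ d → ∣ d ∣ ℚ.< ε) (sym (ℚ.+-inverseʳ p)) 0<ε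

0ℝ : ℝ
0ℝ = fromℚ 0ℚ

fromℤ : ℤ → ℝ
fromℤ z = fromℚ (z ℚ./ 1)

fromℕ : ℕ → ℝ
fromℕ n = fromℤ (ℤ.+ n)

IsInteger : Pred ℝ 0ℓ
IsInteger x = ∃[ z ] x ≃ fromℤ z

+-0-rawMonoid : RawMonoid 0ℓ 0ℓ
+-0-rawMonoid = record { Carrier = ℝ ; _≈_ = _≃_ ; _∙_ = _+_ ; ε = 0ℝ }

open Sum +-0-rawMonoid public using (sum)

Matrix : ℕ → ℕ → Set
Matrix m n = Vector (Vector ℝ n) m

module _ {m n : ℕ} where

  infix 4 _≋_

  _≋_ : Rel (Matrix m n) 0ℓ
  A ≋ B = ∀ i j → A i j ≃ B i j

  𝒯 : Vector ℝ m → Vector ℝ n → Pred (Matrix m n) 0ℓ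
  𝒯 R S A = (∀ i j → 0ℝ ≤ A i j)
          × (∀ i → sum (A i) ≃ R i)
          × (∀ j → sum (transpose A j) ≃ S j)

  r∞ : Matrix m n → Matrix m n
  r∞ A i = reverse (A i)

  𝒯∞ : Vector ℝ m → Vector ℝ n → Pred (Matrix m n) 0ℓ
  𝒯∞ R S A = A ∈ 𝒯 R S × r∞ A ≋ A

  𝒯∞ℤ : Vector ℝ m → Vector ℝ n → Pred (Matrix m n) 0ℓ
  𝒯∞ℤ R S A = A ∈ 𝒯∞ R S × (∀ i j → IsInteger (A i j))

Palindromic : ∀ {n} → Pred (Vector ℝ n) 0ℓ
Palindromic S = ∀ j → S j ≃ reverse S j

Even Odd : Pred ℕ 0ℓ
Even k = 2 ∣ k
Odd  k = ¬ Even k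

o : ∀ {m} → Vector ℕ m → ℕ
o R = count (λ k → ¬? (2 ∣? k)) (tabulate R)

-- Elements of Fin n count from 0, so the ⌈n/2⌉-th one is ⌈n/2⌉ - 1.
middle : ∀ n → .{{NonZero n}} → Fin n
middle (suc k) = fromℕ< {⌈ suc k /2⌉ ∸ 1} (s≤s (ℕ.⌊n/2⌋≤n k))

ParityCondition : ∀ {m n} → .{{NonZero n}} → Vector ℕ m → Vector ℕ n → Set
ParityCondition {n = n} R S = (Even n → ∀ i → Even (R i))
                            × (Odd n → o R ℕ.≤ S (middle n))

{-# OPTIONS --safe #-}

-- A matrix fixed by r∞ is built as B + r∞ B, where B has half the prescribed
-- row sums R and column sums T such that T plus its reversal is S.  Such a B
-- exists in every commutative monoid with the refinement property (equal sums
-- a + b = c + d come from a 2 × 2 array), which ℕ and the nonnegative reals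
-- have: take min(a, c) for the top left entry.  Unlike case distinctions on
-- reals, minima are constructive.
--
-- Over the reals T = S/2.  Over ℕ with n odd, the parity of r_i must be carried
-- by the middle entry of row i, which costs o(R) of the middle column; T is the
-- left half of S, plus half of what remains in the middle column.

module Submission where

open import Defs using (Even; Odd; o; middle; ParityCondition)
open import Algebra.Bundles using (CommutativeMonoid; Monoid)
open import Algebra.Bundles.Raw using (RawMonoid)
import Algebra.Definitions.RawMonoid as RawMonoidSum
import Algebra.Properties.CommutativeMonoid.Sum as CommutativeMonoidSum
import Algebra.Properties.Semiring.Sum as SemiringSum
open import Data.Bool.Base using (if_then_else_)
open import Data.Fin.Base using (Fin; zero; suc; opposite; toℕ; punchIn)
import Data.Fin.Permutation as Permutation
import Data.Fin.Properties as Fin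
open import Data.Integer.Base as ℤ using (-[1+_])
import Data.Integer.Properties as ℤ
open import Data.Nat.Base as ℕ using (ℕ; NonZero; zero; suc; z≤n; s≤s)
open import Data.Nat.Divisibility
  using (_∣?_; divides; _∣0; ∣-refl; ∣1⇒≡1; ∣m∣n⇒∣m+n; ∣m+n∣m⇒∣n; n∣m⇒m%n≡0)
open import Data.Nat.DivMod using (m%n≤m; m%n<n; m≡m%n+[m/n]*n; [m+kn]%n≡m%n)
import Data.Nat.Properties as ℕ
import Data.Nat.Solver as ℕ-Solver
open import Data.Product.Base using (∃-syntax; _×_; _,_; proj₁; proj₂)
open import Data.Rational.Base as ℚ using (ℚ; 0ℚ; ½; ∣_∣)
import Data.Rational.Properties as ℚ
import Data.Rational.Solver as ℚ-Solver
import Data.Rational.Unnormalised.Base as ℚᵘ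
import Data.Rational.Unnormalised.Properties as ℚᵘ
open import Data.Sum.Base using (_⊎_; inj₁; inj₂; [_,_]′)
open import Data.Vec.Functional using (Vector; tail; reverse; transpose; _∷_)
open import Function.Base using (_∘_)
open import Function.Bundles using (_⇔_; mk⇔)
open import Level using (_⊔_)
open import Relation.Binary.Definitions using (tri<; tri≈; tri>)
open import Relation.Binary.PropositionalEquality as ≡ using (_≡_; module ≡-Reasoning)
import Relation.Binary.Reasoning.Setoid as SetoidReasoning
open import Relation.Nullary.Decidable using (Dec; does; yes; no; dec-true; dec-false)
open import Relation.Nullary.Negation using (¬_; contradiction)
open import Relation.Unary using (Satisfiable)

-- Refinement monoids and transport matrices

module Refinement {e ℓ} (M : CommutativeMonoid e ℓ) where
  open CommutativeMonoid M
  open CommutativeMonoidSum M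
  open SetoidReasoning setoid

  record _,_Refines_,_ (a b c d : Carrier) : Set (e ⊔ ℓ) where
    constructor refined
    field
      {x y z w} : Carrier
      row₁ : x ∙ y ≈ a
      row₂ : z ∙ w ≈ b
      col₁ : x ∙ z ≈ c
      col₂ : y ∙ w ≈ d

  sum-reverse : ∀ {n} (v : Vector Carrier n) → sum (reverse v) ≈ sum v
  sum-reverse v = sym (sum-permute v Permutation.reverse)

  HasMargins : ∀ {m n} → Vector Carrier m → Vector Carrier n → Vector (Vector Carrier n) m → Set ℓ
  HasMargins R S A = (∀ i → sum (A i) ≈ R i) × (∀ j → sum (transpose A j) ≈ S j)

  module _ (refine : ∀ {a b c d} → a ∙ b ≈ c ∙ d → a , b Refines c , d) where

    -- Peels off one column at a time: refining `a ∙ b` against the head of `S` and the sum of its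
    -- tail fixes the first entry of each row, and `col₂` poses the same problem for the tail.
    refine-row : ∀ {n a b} (S : Vector Carrier (suc n)) → a ∙ b ≈ sum S →
      ∃[ x ] ∃[ y ] (sum x ≈ a × sum y ≈ b × (∀ j → x j ∙ y j ≈ S j))
    -- The induction starts at one column: with none, `a ∙ b ≈ ε` would not force `a` and `b` to be
    -- trivial, for instance in a group.
    refine-row {zero} {a} {b} S a+b≈S =
      (λ _ → a) , (λ _ → b) , identityʳ a , identityʳ b ,
      λ { zero → trans a+b≈S (identityʳ (S zero)) }
    refine-row {suc n} S a+b≈S with refine a+b≈S
    ... | refined row₁ row₂ col₁ col₂ with refine-row (tail S) col₂
    ... | x , y , Σx≈ , Σy≈ , x+y≈S =
      _ ∷ x , _ ∷ y , trans (∙-congˡ Σx≈) row₁ , trans (∙-congˡ Σy≈) row₂ ,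
      λ { zero → col₁ ; (suc j) → x+y≈S j }

    -- The northwest corner rule in a refinement monoid: the first row is split off against the
    -- total of the remaining ones, and `y` is what it leaves of the column sums.
    transport : ∀ {m n} (R : Vector Carrier (suc m)) (S : Vector Carrier (suc n)) →
      sum R ≈ sum S → ∃[ A ] HasMargins R S A
    transport {zero} R S ΣR≈ΣS =
      (λ _ → S) , (λ { zero → trans (sym ΣR≈ΣS) (identityʳ _) }) , λ j → identityʳ (S j)
    transport {suc m} R S ΣR≈ΣS with refine-row S ΣR≈ΣS
    ... | x , y , Σx≈ , Σy≈ , x+y≈S with transport (tail R) y (sym Σy≈)
    ... | A , rows , cols =
      x ∷ A , (λ { zero → Σx≈ ; (suc i) → rows i }) ,
      λ j → trans (∙-congˡ (cols j)) (x+y≈S j)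

    -- Adding to `B` its reflection doubles the row sums, since reversal preserves a sum, and joins
    -- column `j` with column `opposite j`.
    symmetric-transport : ∀ {m n} .{{_ : NonZero m}} .{{_ : NonZero n}}
      (Q : Vector Carrier m) (T : Vector Carrier n) →
      sum Q ≈ sum T →
      ∃[ A ] ((∀ i j → A i (opposite j) ≈ A i j)
            × HasMargins (λ i → Q i ∙ Q i) (λ j → T j ∙ T (opposite j)) A)
    symmetric-transport {suc _} {suc _} Q T ΣQ≈ΣT with transport Q T ΣQ≈ΣT
    ... | B , rows , cols = (λ i j → B i j ∙ B i (opposite j)) ,
      (λ i j → trans (comm _ _) (∙-congʳ (reflexive (≡.cong (B i) (Fin.opposite-involutive j))))) ,
      (λ i → begin
        ∑[ j < _ ] (B i j ∙ B i (opposite j))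
          ≈⟨ ∑-distrib-+ (B i) (reverse (B i)) ⟩
        sum (B i) ∙ sum (reverse (B i))
          ≈⟨ ∙-cong (rows i) (trans (sum-reverse (B i)) (rows i)) ⟩
        Q i ∙ Q i ∎) ,
      λ j → trans (∑-distrib-+ (transpose B j) (transpose B (opposite j)))
                  (∙-cong (cols j) (cols (opposite j)))

module _ {a b ℓ₁ ℓ₂} (M : RawMonoid a ℓ₁) (N : Monoid b ℓ₂) where
  private
    module M = RawMonoid M
    module N = Monoid N

  sum-homo : (f : M.Carrier → N.Carrier) → f M.ε N.≈ N.ε → (∀ x y → f (x M.∙ y) N.≈ f x N.∙ f y) →
    ∀ {n} (v : Vector M.Carrier n) → f (RawMonoidSum.sum M v) N.≈
      RawMonoidSum.sum N.rawMonoid (λ i → f (v i))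
  sum-homo f f-ε f-∙ {zero}  v = f-ε
  sum-homo f f-ε f-∙ {suc n} v =
    N.trans (f-∙ (v zero) (RawMonoidSum.sum M (tail v))) (N.∙-congˡ (sum-homo f f-ε f-∙ (tail v)))

-- Natural margins

module ℕ-Refinement = Refinement ℕ.+-0-commutativeMonoid

module ℕ-Parity where
  open import Data.Nat.Base using (_+_; _*_; _∸_; _≤_; _/_; _%_; ⌊_/2⌋)
  open ≡ using (refl; cong; cong₂; subst; sym; trans)
  open SemiringSum ℕ.+-*-semiring
    using (sum; ∑-distrib-+; sum-cong-≗; sum-remove; sum-replicate-zero;
           *-distribˡ-sum; *-distribʳ-sum)
  open ℕ-Solver.+-*-Solver using (solve; _:+_; _:*_; con; _:=_)
  open ℕ-Refinement using (HasMargins)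

  -- The top left entry is the minimum of `a` and `c`. Whichever is smaller is used up by it, which
  -- leaves a zero beside it in the row or below it in the column.
  ℕ-refine : ∀ {a b c d} → a + b ≡ c + d → ℕ-Refinement._,_Refines_,_ a b c d
  ℕ-refine {a} {b} {c} {d} a+b≡c+d with ℕ.≤-total a c
  ... | inj₁ a≤c = record
    { x = a ; y = 0 ; z = c ∸ a ; w = d
    ; row₁ = ℕ.+-identityʳ a
    ; row₂ = ℕ.+-cancelˡ-≡ a _ _ (trans (sym (ℕ.+-assoc a (c ∸ a) d))
               (trans (cong (_+ d) (ℕ.m+[n∸m]≡n a≤c)) (sym a+b≡c+d)))
    ; col₁ = ℕ.m+[n∸m]≡n a≤c
    ; col₂ = refl }
  ... | inj₂ c≤a = record
    { x = c ; y = a ∸ c ; z = 0 ; w = b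
    ; row₁ = ℕ.m+[n∸m]≡n c≤a
    ; row₂ = refl
    ; col₁ = ℕ.+-identityʳ c
    ; col₂ = ℕ.+-cancelˡ-≡ c _ _ (trans (sym (ℕ.+-assoc c (a ∸ c) b))
               (trans (cong (_+ b) (ℕ.m+[n∸m]≡n c≤a)) a+b≡c+d)) }

  sum-mono-≤ : ∀ {n} {u v : Vector ℕ n} → (∀ i → u i ≤ v i) → sum u ≤ sum v
  sum-mono-≤ {zero}  u≤v = z≤n
  sum-mono-≤ {suc n} u≤v = ℕ.+-mono-≤ (u≤v zero) (sum-mono-≤ (u≤v ∘ suc))

  sum-zero : ∀ {n} {v : Vector ℕ n} → (∀ i → v i ≡ 0) → sum v ≡ 0
  sum-zero {n} v≡0 = trans (sum-cong-≗ v≡0) (sum-replicate-zero n)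

  m+m≡n+n⇒m≡n : ∀ {m n} → m + m ≡ n + n → m ≡ n
  m+m≡n+n⇒m≡n {m} {n} eq =
    trans (ℕ.n≡⌊n+n/2⌋ m) (trans (cong ⌊_/2⌋ eq) (sym (ℕ.n≡⌊n+n/2⌋ n)))

  m*2≡m+m : ∀ m → m * 2 ≡ m + m
  m*2≡m+m = solve 1 (λ m → m :* con 2 := m :+ m) refl

  even-m+m : ∀ m → Even (m + m)
  even-m+m m = divides m (sym (m*2≡m+m m))

  even⊎even-suc : ∀ n → Even n ⊎ Even (suc n)
  even⊎even-suc zero = inj₁ (2 ∣0)
  even⊎even-suc (suc n) with even⊎even-suc n
  ... | inj₁ 2∣n   = inj₂ (∣m∣n⇒∣m+n ∣-refl 2∣n)
  ... | inj₂ 2∣1+n = inj₁ 2∣1+n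

  even-suc⇒odd : ∀ {n} → Even n → Odd (suc n)
  even-suc⇒odd {n} 2∣n 2∣1+n with ∣1⇒≡1 (∣m+n∣m⇒∣n (subst Even (ℕ.+-comm 1 n) 2∣1+n) 2∣n)
  ... | ()

  -- Divisibility by 2 is decided through the remainder, so matching on `R zero % 2` also evaluates
  -- the count; `m%n<n` excludes remainders above 1.
  o≡∑%2 : ∀ {m} (R : Vector ℕ m) → o R ≡ sum (λ i → R i % 2)
  o≡∑%2 {zero} R = refl
  o≡∑%2 {suc m} R with R zero % 2 | m%n<n (R zero) 2
  ... | 0 | _ = o≡∑%2 (tail R)
  ... | 1 | _ = cong suc (o≡∑%2 (tail R))
  ... | suc (suc _) | s≤s (s≤s ())

  -- Indicators, the middle column and palindromes

  indicator : ∀ {p} {P : Set p} → Dec P → ℕ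
  indicator P? = if does P? then 1 else 0

  indicator-true : ∀ {p} {P : Set p} (P? : Dec P) → P → indicator P? ≡ 1
  indicator-true P? p = cong (if_then 1 else 0) (dec-true P? p)

  indicator-false : ∀ {p} {P : Set p} (P? : Dec P) → ¬ P → indicator P? ≡ 0
  indicator-false P? ¬p = cong (if_then 1 else 0) (dec-false P? ¬p)

  indicator-trichotomy : ∀ {n} (i j : Fin n) →
    indicator (i Fin.<? j) + indicator (j Fin.<? i) + indicator (i Fin.≟ j) ≡ 1
  indicator-trichotomy i j with Fin.<-cmp i j
  ... | tri< i<j i≢j j≮i = cong₂ _+_
    (cong₂ _+_ (indicator-true (i Fin.<? j) i<j) (indicator-false (j Fin.<? i) j≮i))
    (indicator-false (i Fin.≟ j) i≢j)
  ... | tri≈ i≮j i≡j j≮i = cong₂ _+_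
    (cong₂ _+_ (indicator-false (i Fin.<? j) i≮j) (indicator-false (j Fin.<? i) j≮i))
    (indicator-true (i Fin.≟ j) i≡j)
  ... | tri> i≮j i≢j j<i = cong₂ _+_
    (cong₂ _+_ (indicator-false (i Fin.<? j) i≮j) (indicator-true (j Fin.<? i) j<i))
    (indicator-false (i Fin.≟ j) i≢j)

  -- For odd `n` the unit vector of the middle column, for even `n` the zero vector. As a numerical
  -- coefficient it lets one formula serve both parities and passes through sums by distributivity.
  central : ∀ {n} → Vector ℕ n
  central j = indicator (j Fin.≟ opposite j)

  left : ∀ {n} → Vector ℕ n → Vector ℕ n
  left v j = indicator (j Fin.<? opposite j) * v j

  ∑-central-* : ∀ {n} x → sum (λ (j : Fin n) → central j * x) ≡ sum (central {n}) * x
  ∑-central-* {n} x = sym (*-distribʳ-sum x (central {n}))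

  self-opposite⇒toℕ+toℕ : ∀ {k} {j : Fin (suc k)} → j ≡ opposite j → toℕ j + toℕ j ≡ k
  self-opposite⇒toℕ+toℕ {k} {j} j≡ = begin
    toℕ j + toℕ j             ≡⟨ cong (λ i → toℕ j + toℕ i) j≡ ⟩
    toℕ j + toℕ (opposite j)  ≡⟨ cong (toℕ j +_) (Fin.opposite-prop j) ⟩
    toℕ j + (k ∸ toℕ j)       ≡⟨ ℕ.m+[n∸m]≡n (Fin.toℕ≤pred[n] j) ⟩
    k                         ∎
    where open ≡-Reasoning

  -- `⌈ suc k /2⌉ ∸ 1` reduces to `⌊ k /2⌋`, which disposes of the shift between counting from 1 and
  -- from 0.
  toℕ-middle : ∀ k → toℕ (middle (suc k)) ≡ ⌊ k /2⌋
  toℕ-middle k = Fin.toℕ-fromℕ< (s≤s (ℕ.⌊n/2⌋≤n k))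

  self-opposite⇒middle : ∀ {k} {j : Fin (suc k)} → j ≡ opposite j → j ≡ middle (suc k)
  self-opposite⇒middle {k} {j} j≡ = Fin.toℕ-injective (begin
    toℕ j                   ≡⟨ ℕ.n≡⌊n+n/2⌋ (toℕ j) ⟩
    ⌊ toℕ j + toℕ j /2⌋     ≡⟨ cong ⌊_/2⌋ (self-opposite⇒toℕ+toℕ j≡) ⟩
    ⌊ k /2⌋                 ≡⟨ toℕ-middle k ⟨
    toℕ (middle (suc k))    ∎)
    where open ≡-Reasoning

  self-opposite⇒odd : ∀ {k} {j : Fin (suc k)} → j ≡ opposite j → Odd (suc k)
  self-opposite⇒odd {k} {j} j≡ =
    even-suc⇒odd (subst Even (self-opposite⇒toℕ+toℕ j≡) (even-m+m (toℕ j)))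

  middle-self-opposite : ∀ {k} → Odd (suc k) → middle (suc k) ≡ opposite (middle (suc k))
  middle-self-opposite {k} odd with even⊎even-suc k
  ... | inj₂ even = contradiction even odd
  -- Here `k = h + h`: the middle column has `h` columns on either side, and `k ∸ h` is `h` again.
  ... | inj₁ (divides h k≡h*2) = Fin.toℕ-injective (begin
    toℕ (middle (suc k))               ≡⟨ mid≡h ⟩
    h                                  ≡⟨ ℕ.m+n∸m≡n h h ⟨
    h + h ∸ h                          ≡⟨ cong₂ _∸_ k≡h+h mid≡h ⟨
    k ∸ toℕ (middle (suc k))           ≡⟨ Fin.opposite-prop (middle (suc k)) ⟨
    toℕ (opposite (middle (suc k)))    ∎)
    where
    open ≡-Reasoning
    k≡h+h : k ≡ h + h
    k≡h+h = trans k≡h*2 (m*2≡m+m h)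
    mid≡h : toℕ (middle (suc k)) ≡ h
    mid≡h = trans (toℕ-middle k) (trans (cong ⌊_/2⌋ k≡h+h) (sym (ℕ.n≡⌊n+n/2⌋ h)))

  ∑-central-even : ∀ {k} → Even (suc k) → sum (central {suc k}) ≡ 0
  ∑-central-even even = sum-zero λ j →
    indicator-false (j Fin.≟ opposite j) λ j≡ → self-opposite⇒odd j≡ even

  -- Only the middle is its own opposite, so once its term is split off all others vanish.
  ∑-central-odd : ∀ {k} → Odd (suc k) → sum (central {suc k}) ≡ 1
  ∑-central-odd {k} odd = trans (sum-remove {i = mid} central) (cong₂ _+_
    (indicator-true (mid Fin.≟ opposite mid) (middle-self-opposite odd))
    (sum-zero λ j → indicator-false (punchIn mid j Fin.≟ opposite (punchIn mid j))
      λ p → Fin.punchInᵢ≢i mid j (self-opposite⇒middle p)))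
    where mid = middle (suc k)

  central-opposite : ∀ {n} (j : Fin n) → central (opposite j) ≡ central j
  central-opposite j with j Fin.≟ opposite j
  ... | yes j≡ = indicator-true (opposite j Fin.≟ _) (cong opposite j≡)
  ... | no  j≢ = indicator-false (opposite j Fin.≟ _) λ p →
    j≢ (sym (trans p (Fin.opposite-involutive j)))

  central-*-middle : ∀ {k} (v : Vector ℕ (suc k)) j →
    central j * v j ≡ central j * v (middle (suc k))
  central-*-middle v j with j Fin.≟ opposite j
  ... | yes j≡ = cong (λ i → 1 * v i) (self-opposite⇒middle j≡)
  ... | no  _  = refl

  -- A column lies left of its reflection, right of it, or on it, so exactly one of the three
  -- coefficients is 1. On the right, `pal` replaces the reflected entry by `v j`; in the centre,
  -- `j` is the middle.
  palindrome-split : ∀ {k} (v : Vector ℕ (suc k)) → (∀ j → v (opposite j) ≡ v j) → ∀ j →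
    v j ≡ left v j + left v (opposite j) + central j * v (middle (suc k))
  palindrome-split {k} v pal j = sym (begin
    a * v j + left v (opposite j) + c * v (middle (suc k))
      ≡⟨ cong₂ (λ x y → a * v j + x + y)
           (cong₂ (λ i x → indicator (opposite j Fin.<? i) * x) (Fin.opposite-involutive j) (pal j))
           (sym (central-*-middle v j)) ⟩
    a * v j + b * v j + c * v j
      ≡⟨ solve 4 (λ a b c v → a :* v :+ b :* v :+ c :* v := (a :+ b :+ c) :* v) refl a b c (v j) ⟩
    (a + b + c) * v j
      ≡⟨ cong (_* v j) (indicator-trichotomy j (opposite j)) ⟩
    1 * v j
      ≡⟨ ℕ.*-identityˡ (v j) ⟩
    v j ∎)
    where
    open ≡-Reasoning
    a = indicator (j Fin.<? opposite j)
    b = indicator (opposite j Fin.<? j)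
    c = central j

  -- The source of the parity condition: the two halves have equal sums, so modulo 2 only the middle
  -- entry remains, and nothing at all if the length is even.
  palindrome-sum : ∀ {k} (v : Vector ℕ (suc k)) → (∀ j → v (opposite j) ≡ v j) →
    sum v ≡ sum (left v) + sum (left v) + sum (central {suc k}) * v (middle (suc k))
  palindrome-sum {k} v pal = begin
    sum v
      ≡⟨ sum-cong-≗ (palindrome-split v pal) ⟩
    sum (λ j → left v j + left v (opposite j) + central j * v mid)
      ≡⟨ ∑-distrib-+ (λ j → left v j + left v (opposite j)) (λ j → central j * v mid) ⟩
    sum (λ j → left v j + left v (opposite j)) + sum {suc k} (λ j → central j * v mid)
      ≡⟨ cong₂ _+_ (∑-distrib-+ (left v) (reverse (left v))) (∑-central-* {suc k} (v mid)) ⟩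
    sum (left v) + sum (reverse (left v)) + sum (central {suc k}) * v mid
      ≡⟨ cong (λ x → sum (left v) + x + sum (central {suc k}) * v mid)
           (ℕ-Refinement.sum-reverse (left v)) ⟩
    sum (left v) + sum (left v) + sum (central {suc k}) * v mid ∎
    where
    open ≡-Reasoning
    mid = middle (suc k)

  -- The parity condition for natural matrices

  SymmetricWithMargins : ∀ {m n} → Vector ℕ m → Vector ℕ n → Vector (Vector ℕ n) m → Set
  SymmetricWithMargins R S A = (∀ i j → A i (opposite j) ≡ A i j) × HasMargins R S A

  -- Each row is a palindrome. With an odd number of columns its middle entry has the parity of its
  -- sum, so every odd row puts at least 1 into the middle column; adding up the rows bounds `o R`.
  parity-necessary : ∀ {m n} .{{_ : NonZero n}} {R : Vector ℕ m} {S : Vector ℕ n} {A} →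
    SymmetricWithMargins R S A → ParityCondition R S
  parity-necessary {n = suc k} {R} {S} {A} (pal , rows , cols) = even-case , odd-case
    where
    mid = middle (suc k)
    L = λ i → sum (left (A i))

    -- The variable `c` lets the two cases insert the literals 0 and 1, on which `c * A i mid`
    -- computes.
    row : ∀ {c} → sum (central {suc k}) ≡ c → ∀ i → R i ≡ L i + L i + c * A i mid
    row refl i = trans (sym (rows i)) (palindrome-sum (A i) (pal i))

    even-case : Even (suc k) → ∀ i → Even (R i)
    even-case even i = subst Even
      (sym (trans (row (∑-central-even even) i) (ℕ.+-identityʳ (L i + L i)))) (even-m+m (L i))

    odd-case : Odd (suc k) → o R ≤ S mid
    odd-case odd = begin
      o R                      ≡⟨ o≡∑%2 R ⟩
      sum (λ i → R i % 2)      ≤⟨ sum-mono-≤ R%2≤ ⟩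
      sum (λ i → A i mid)      ≡⟨ cols mid ⟩
      S mid                    ∎
      where
      open ℕ.≤-Reasoning
      R%2≤ : ∀ i → R i % 2 ≤ A i mid
      R%2≤ i = begin
        R i % 2
          ≡⟨ cong (_% 2) (trans (row (∑-central-odd odd) i)
               (solve 2 (λ l a → l :+ l :+ con 1 :* a := a :+ l :* con 2) refl (L i) (A i mid))) ⟩
        (A i mid + L i * 2) % 2
          ≡⟨ [m+kn]%n≡m%n (A i mid) (L i) 2 ⟩
        A i mid % 2
          ≤⟨ m%n≤m (A i mid) 2 ⟩
        A i mid ∎

  m≡m/2+m/2+m%2 : ∀ m → m ≡ m / 2 + m / 2 + m % 2
  m≡m/2+m/2+m%2 m = trans (m≡m%n+[m/n]*n m 2)
    (trans (ℕ.+-comm (m % 2) _) (cong (_+ m % 2) (m*2≡m+m (m / 2))))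

  -- Since sum central is 0 or 1 according to the parity of the number of
  -- columns, this covers both cases; t is what remains of the middle column sum,
  -- halved, after the odd rows have each taken 1.
  parity-construct : ∀ {m k} .{{_ : NonZero m}} (R : Vector ℕ m) (S : Vector ℕ (suc k)) t →
    (∀ j → S (opposite j) ≡ S j) →
    (∀ i → sum (central {suc k}) * (R i % 2) ≡ R i % 2) →
    (∀ j → central {suc k} j * (t + t + sum (λ i → R i % 2)) ≡ central j * S (middle (suc k))) →
    sum (λ i → R i / 2) ≡ sum (left S) + sum (central {suc k}) * t →
    ∃[ A ] SymmetricWithMargins R S A
  parity-construct {k = k} R S t pal ε-cond t-cond ∑-cond =
    let B , pal-B , rows , cols = ℕ-Refinement.symmetric-transport ℕ-refine (λ i → R i / 2) T
          (trans ∑-cond (sym (trans (∑-distrib-+ (left S) (λ j → central j * t))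
            (cong (sum (left S) +_) (∑-central-* {suc k} t)))))
    in
    -- `B` supplies the even part of each row sum. The remainders go into the middle column, which
    -- the reflection fixes; if there is none, `ε-cond` makes them 0.
    (λ i j → B i j + central j * ε i) ,
    (λ i j → cong₂ (λ b c → b + c * ε i) (pal-B i j) (central-opposite j)) ,
    (λ i → begin
      sum (λ j → B i j + central j * ε i)
        ≡⟨ ∑-distrib-+ (B i) (λ j → central j * ε i) ⟩
      sum (B i) + sum (λ (j : Fin (suc k)) → central j * ε i)
        ≡⟨ cong₂ _+_ (rows i) (trans (∑-central-* {suc k} (ε i)) (ε-cond i)) ⟩
      R i / 2 + R i / 2 + ε i
        ≡⟨ m≡m/2+m/2+m%2 (R i) ⟨
      R i ∎) ,
    λ j → begin
      sum (λ i → B i j + central j * ε i)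
        ≡⟨ ∑-distrib-+ (transpose B j) (λ i → central j * ε i) ⟩
      sum (transpose B j) + sum (λ i → central j * ε i)
        ≡⟨ cong₂ _+_ (cols j) (sym (*-distribˡ-sum (central j) ε)) ⟩
      left S j + central j * t + (left S (opposite j) + central (opposite j) * t) + central j * sum ε
        ≡⟨ cong (λ c → left S j + central j * t + (left S (opposite j) + c * t) + central j * sum ε)
             (central-opposite j) ⟩
      left S j + central j * t + (left S (opposite j) + central j * t) + central j * sum ε
        ≡⟨ solve 5 (λ l r c t e →
               l :+ c :* t :+ (r :+ c :* t) :+ c :* e := l :+ r :+ c :* (t :+ t :+ e))
             refl (left S j) (left S (opposite j)) (central j) t (sum ε) ⟩
      left S j + left S (opposite j) + central j * (t + t + sum ε)
        ≡⟨ cong (left S j + left S (opposite j) +_) (t-cond j) ⟩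
      left S j + left S (opposite j) + central j * S (middle (suc k))
        ≡⟨ palindrome-split S pal j ⟨
      S j ∎
    where
    open ≡-Reasoning
    ε = λ i → R i % 2
    T : Vector ℕ (suc k)
    T j = left S j + central j * t

  parity-sufficient : ∀ {m n} .{{_ : NonZero m}} .{{_ : NonZero n}}
    (R : Vector ℕ m) (S : Vector ℕ n) → sum R ≡ sum S →
    (∀ j → S (opposite j) ≡ S j) → ParityCondition R S → ∃[ A ] SymmetricWithMargins R S A
  parity-sufficient {n = suc k} R S ∑R≡∑S pal (even-cond , odd-cond) = by-parity (2 ∣? suc k)
    where
    open ≡-Reasoning
    mid = middle (suc k)
    ε = λ i → R i % 2
    Q = sum (λ i → R i / 2)
    L = sum (left S)

    -- The total of all entries, counted once by rows and once by columns; `c` will be 0 or 1.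
    margins : ∀ {c} → sum (central {suc k}) ≡ c → Q + Q + sum ε ≡ L + L + c * S mid
    margins refl = begin
      Q + Q + sum ε
        ≡⟨ cong (_+ sum ε) (∑-distrib-+ (λ i → R i / 2) (λ i → R i / 2)) ⟨
      sum (λ i → R i / 2 + R i / 2) + sum ε
        ≡⟨ ∑-distrib-+ (λ i → R i / 2 + R i / 2) ε ⟨
      sum (λ i → R i / 2 + R i / 2 + R i % 2)
        ≡⟨ sum-cong-≗ (λ i → m≡m/2+m/2+m%2 (R i)) ⟨
      sum R
        ≡⟨ ∑R≡∑S ⟩
      sum S
        ≡⟨ palindrome-sum S pal ⟩
      L + L + sum (central {suc k}) * S mid ∎

    by-parity : Dec (Even (suc k)) → ∃[ A ] SymmetricWithMargins R S A
    -- Without a middle column every coefficient of `t` is 0, so it gets the default value 0, and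
    -- `margins` becomes `Q + Q ≡ L + L`.
    by-parity (yes even) = parity-construct R S 0 pal
      (λ i → trans (cong (c *_) (ε≡0 i)) (trans (ℕ.*-zeroʳ c) (sym (ε≡0 i))))
      (λ j → trans (off-centre j _) (sym (off-centre j _)))
      (trans (m+m≡n+n⇒m≡n (begin
        Q + Q            ≡⟨ ℕ.+-identityʳ (Q + Q) ⟨
        Q + Q + 0        ≡⟨ cong (Q + Q +_) (sum-zero ε≡0) ⟨
        Q + Q + sum ε    ≡⟨ margins (∑-central-even even) ⟩
        L + L + 0        ≡⟨ ℕ.+-identityʳ (L + L) ⟩
        L + L            ∎))
        (sym (trans (cong (L +_) (ℕ.*-zeroʳ c)) (ℕ.+-identityʳ L))))
      where
      c = sum (central {suc k})

      ε≡0 : ∀ i → R i % 2 ≡ 0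
      ε≡0 i = n∣m⇒m%n≡0 (R i) 2 (even-cond even i)

      off-centre : ∀ (j : Fin (suc k)) x → central j * x ≡ 0
      off-centre j x = cong (_* x)
        (indicator-false (j Fin.≟ opposite j) λ j≡ → self-opposite⇒odd j≡ even)
    by-parity (no odd) = parity-construct R S t pal
      (λ i → trans (cong (_* ε i) (∑-central-odd odd)) (ℕ.*-identityˡ (ε i)))
      (λ j → cong (central j *_) t+t+∑ε≡s)
      (trans (sym L+t≡Q) (cong (L +_)
        (sym (trans (cong (_* t) (∑-central-odd odd)) (ℕ.*-identityˡ t)))))
      where
      -- By `eq` this is half of what `S mid` exceeds `sum ε` by, obtained without proving that
      -- excess even.
      t = Q ∸ L

      eq : Q + Q + sum ε ≡ L + L + S mid
      eq = trans (margins (∑-central-odd odd)) (cong (L + L +_) (ℕ.*-identityˡ (S mid)))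

      -- The bound on `o R` enters here: were `Q < L`, then `sum ε ≤ S mid` would make the left side
      -- of `eq` strictly smaller than the right.
      L≤Q : L ≤ Q
      L≤Q = ℕ.≮⇒≥ λ Q<L → ℕ.<-irrefl eq
        (ℕ.+-mono-<-≤ (ℕ.+-mono-< Q<L Q<L) (subst (_≤ S mid) (o≡∑%2 R) (odd-cond odd)))

      L+t≡Q : L + t ≡ Q
      L+t≡Q = ℕ.m+[n∸m]≡n L≤Q

      t+t+∑ε≡s : t + t + sum ε ≡ S mid
      t+t+∑ε≡s = ℕ.+-cancelˡ-≡ (L + L) _ _ (begin
        L + L + (t + t + sum ε)
          ≡⟨ solve 3 (λ l t e → l :+ l :+ (t :+ t :+ e) := (l :+ t) :+ (l :+ t) :+ e)
               refl L t (sum ε) ⟩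
        (L + t) + (L + t) + sum ε
          ≡⟨ cong (λ q → q + q + sum ε) L+t≡Q ⟩
        Q + Q + sum ε
          ≡⟨ eq ⟩
        L + L + S mid ∎)

-- Cauchy reals

open import Defs
open ≡ using (refl; cong; subst)
open ℚ-Solver.+-*-Solver using (solve; _:+_; _:*_; :-_; _:-_; con; _:=_)

open _≃_ using (close)

½-pos : ∀ {ε} → 0ℚ ℚ.< ε → 0ℚ ℚ.< ½ ℚ.* ε
½-pos = ℚ.*-monoʳ-<-pos ½

½*[p+2ε]≡½*p+ε : ∀ p ε → ½ ℚ.* (p ℚ.+ (ε ℚ.+ ε)) ≡ ½ ℚ.* p ℚ.+ ε
½*[p+2ε]≡½*p+ε = solve 2 (λ p ε → con ½ :* (p :+ (ε :+ ε)) := con ½ :* p :+ ε) refl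

p<p+ε : ∀ p {ε} → 0ℚ ℚ.< ε → p ℚ.< p ℚ.+ ε
p<p+ε p {ε} 0<ε = subst (ℚ._< p ℚ.+ ε) (ℚ.+-identityʳ p) (ℚ.+-monoʳ-< p 0<ε)

p≤∣p∣ : ∀ p → p ℚ.≤ ∣ p ∣
p≤∣p∣ p with ℚ.≤-total 0ℚ p
... | inj₁ 0≤p = ℚ.≤-reflexive (≡.sym (ℚ.0≤p⇒∣p∣≡p 0≤p))
... | inj₂ p≤0 = ℚ.≤-trans p≤0 (ℚ.0≤∣p∣ p)

∣p-q∣<ε⇒p<q+ε : ∀ p q {ε} → ∣ p ℚ.- q ∣ ℚ.< ε → p ℚ.< q ℚ.+ ε
∣p-q∣<ε⇒p<q+ε p q d = subst (ℚ._< _)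
  (solve 2 (λ p q → q :+ (p :- q) := p) refl p q)
  (ℚ.+-monoʳ-< q (ℚ.≤-<-trans (p≤∣p∣ (p ℚ.- q)) d))

p<q+ε⇒p-q<ε : ∀ p q {ε} → p ℚ.< q ℚ.+ ε → p ℚ.- q ℚ.< ε
p<q+ε⇒p-q<ε p q {ε} lt = subst (p ℚ.- q ℚ.<_)
  (solve 2 (λ q ε → q :+ ε :- q := ε) refl q ε) (ℚ.+-monoˡ-< (ℚ.- q) lt)

p<q+ε∧q<p+ε⇒∣p-q∣<ε : ∀ p q {ε} → p ℚ.< q ℚ.+ ε → q ℚ.< p ℚ.+ ε → ∣ p ℚ.- q ∣ ℚ.< ε
p<q+ε∧q<p+ε⇒∣p-q∣<ε p q p<q+ε q<p+ε with ℚ.∣p∣≡p∨∣p∣≡-p (p ℚ.- q)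
... | inj₁ eq = subst (ℚ._< _) (≡.sym eq) (p<q+ε⇒p-q<ε p q p<q+ε)
... | inj₂ eq = subst (ℚ._< _)
  (≡.trans (solve 2 (λ p q → q :- p := :- (p :- q)) refl p q) (≡.sym eq))
  (p<q+ε⇒p-q<ε q p q<p+ε)

∣p-q∣≡∣q-p∣ : ∀ p q → ∣ p ℚ.- q ∣ ≡ ∣ q ℚ.- p ∣
∣p-q∣≡∣q-p∣ p q = ≡.trans (cong ∣_∣ (solve 2 (λ p q → p :- q := :- (q :- p)) refl p q))
                         (ℚ.∣-p∣≡∣p∣ (q ℚ.- p))

p<q⊓r : ∀ {p} q r {ε} → p ℚ.< q ℚ.+ ε → p ℚ.< r ℚ.+ ε → p ℚ.< q ℚ.⊓ r ℚ.+ ε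
p<q⊓r q r p<q+ε p<r+ε with ℚ.⊓-sel q r
... | inj₁ eq = subst (λ s → _ ℚ.< s ℚ.+ _) (≡.sym eq) p<q+ε
... | inj₂ eq = subst (λ s → _ ℚ.< s ℚ.+ _) (≡.sym eq) p<r+ε

oneSided : ∀ x → IsCauchy x → ∀ ε → 0ℚ ℚ.< ε →
  ∃[ N ] (∀ k l → N ℕ.≤ k → N ℕ.≤ l → x k ℚ.< x l ℚ.+ ε)
oneSided x cx ε 0<ε with cx ε 0<ε
... | N , p = N , λ k l N≤k N≤l → ∣p-q∣<ε⇒p<q+ε (x k) (x l) (p k l N≤k N≤l)

-- Since `k` and `l` range over the same tail, exchanging them yields the other half of the bound on
-- the absolute value. Halves and minima thus need estimates in one direction only.
cauchyFromOneSided : ∀ x →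
  (∀ ε → 0ℚ ℚ.< ε → ∃[ N ] (∀ k l → N ℕ.≤ k → N ℕ.≤ l → x k ℚ.< x l ℚ.+ ε)) → IsCauchy x
cauchyFromOneSided x h ε 0<ε with h ε 0<ε
... | N , p = N , λ k l N≤k N≤l →
  p<q+ε∧q<p+ε⇒∣p-q∣<ε (x k) (x l) (p k l N≤k N≤l) (p l k N≤l N≤k)

abstract
  neg-cauchy : ∀ x → IsCauchy (λ k → ℚ.- seq x k)
  neg-cauchy x ε 0<ε =
    let N , p = cauchy x ε 0<ε in
    N , λ k l N≤k N≤l → subst (ℚ._< ε)
      (≡.trans (≡.sym (ℚ.∣-p∣≡∣p∣ (seq x k ℚ.- seq x l))) (cong ∣_∣ (ℚ.neg-distrib-+ (seq x k) _)))
      (p k l N≤k N≤l)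

  half-cauchy : ∀ x → IsCauchy (λ k → ½ ℚ.* seq x k)
  half-cauchy x = cauchyFromOneSided _ λ ε 0<ε →
    let N , p = oneSided (seq x) (cauchy x) (ε ℚ.+ ε) (ℚ.+-mono-< 0<ε 0<ε) in
    N , λ k l N≤k N≤l → subst (½ ℚ.* seq x k ℚ.<_) (½*[p+2ε]≡½*p+ε (seq x l) ε)
      (ℚ.*-monoʳ-<-pos ½ (p k l N≤k N≤l))

  -- The minimum at `k` is below both terms at `k`, hence below both terms at `l` up to `ε`, hence
  -- below their minimum up to `ε`.
  ⊓-cauchy : ∀ x y → IsCauchy (λ k → seq x k ℚ.⊓ seq y k)
  ⊓-cauchy x y = cauchyFromOneSided _ λ ε 0<ε →
    let M , p = oneSided (seq x) (cauchy x) ε 0<ε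
        N , q = oneSided (seq y) (cauchy y) ε 0<ε in
    M ℕ.⊔ N , λ k l ≤k ≤l → p<q⊓r (seq x l) (seq y l)
      (ℚ.≤-<-trans (ℚ.p⊓q≤p (seq x k) (seq y k))
                   (p k l (ℕ.m⊔n≤o⇒m≤o M N ≤k) (ℕ.m⊔n≤o⇒m≤o M N ≤l)))
      (ℚ.≤-<-trans (ℚ.p⊓q≤q (seq x k) (seq y k))
                   (q k l (ℕ.m⊔n≤o⇒n≤o M N ≤k) (ℕ.m⊔n≤o⇒n≤o M N ≤l)))

neg : ℝ → ℝ
neg x = mkℝ (λ k → ℚ.- seq x k) (neg-cauchy x)

half : ℝ → ℝ
half x = mkℝ (λ k → ½ ℚ.* seq x k) (half-cauchy x)

infixl 7 _⊓_

_⊓_ : ℝ → ℝ → ℝ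
x ⊓ y = mkℝ (λ k → seq x k ℚ.⊓ seq y k) (⊓-cauchy x y)

pointwise⇒≤ : ∀ {x y} → (∀ k → seq x k ℚ.≤ seq y k) → x ≤ y
pointwise⇒≤ {x} {y} x≤y = mk≤ λ ε 0<ε → 0 , λ k _ → ℚ.≤-<-trans (x≤y k) (p<p+ε (seq y k) 0<ε)

≤-trans : ∀ {x y z} → x ≤ y → y ≤ z → x ≤ z
≤-trans {x} {y} {z} (mk≤ x≤y) (mk≤ y≤z) = mk≤ λ ε 0<ε →
  let M , p = x≤y (½ ℚ.* ε) (½-pos 0<ε)
      N , q = y≤z (½ ℚ.* ε) (½-pos 0<ε) in
  M ℕ.⊔ N , λ k ≤k → subst (seq x k ℚ.<_)
    (solve 2 (λ c ε → c :+ con ½ :* ε :+ con ½ :* ε := c :+ ε) refl (seq z k) ε)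
    (ℚ.<-trans (p k (ℕ.m⊔n≤o⇒m≤o M N ≤k))
               (ℚ.+-monoˡ-< (½ ℚ.* ε) (q k (ℕ.m⊔n≤o⇒n≤o M N ≤k))))

-- Transitivity of `≃` and its congruence for `+` and `half` are reduced through this to the
-- corresponding facts about `≤`.
≤-antisym : ∀ {x y} → x ≤ y → y ≤ x → x ≃ y
≤-antisym {x} {y} (mk≤ x≤y) (mk≤ y≤x) = mk≃ λ ε 0<ε →
  let M , p = x≤y ε 0<ε
      N , q = y≤x ε 0<ε in
  M ℕ.⊔ N , λ k ≤k → p<q+ε∧q<p+ε⇒∣p-q∣<ε (seq x k) (seq y k)
    (p k (ℕ.m⊔n≤o⇒m≤o M N ≤k)) (q k (ℕ.m⊔n≤o⇒n≤o M N ≤k))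

+-mono-≤ : ∀ {x y u v} → x ≤ y → u ≤ v → x + u ≤ y + v
+-mono-≤ {x} {y} {u} {v} (mk≤ x≤y) (mk≤ u≤v) = mk≤ λ ε 0<ε →
  let M , p = x≤y (½ ℚ.* ε) (½-pos 0<ε)
      N , q = u≤v (½ ℚ.* ε) (½-pos 0<ε) in
  M ℕ.⊔ N , λ k ≤k → subst (seq (x + u) k ℚ.<_)
    (solve 3 (λ b d ε → b :+ con ½ :* ε :+ (d :+ con ½ :* ε) := b :+ d :+ ε)
       refl (seq y k) (seq v k) ε)
    (ℚ.+-mono-< (p k (ℕ.m⊔n≤o⇒m≤o M N ≤k)) (q k (ℕ.m⊔n≤o⇒n≤o M N ≤k)))

⊓-glb : ∀ {x y z} → z ≤ x → z ≤ y → z ≤ x ⊓ y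
⊓-glb {x} {y} (mk≤ z≤x) (mk≤ z≤y) = mk≤ λ ε 0<ε →
  let M , p = z≤x ε 0<ε
      N , q = z≤y ε 0<ε in
  M ℕ.⊔ N , λ k ≤k → p<q⊓r (seq x k) (seq y k)
    (p k (ℕ.m⊔n≤o⇒m≤o M N ≤k)) (q k (ℕ.m⊔n≤o⇒n≤o M N ≤k))

≃⇒≤ : ∀ {x y} → x ≃ y → x ≤ y
≃⇒≤ {x} {y} (mk≃ x≃y) = mk≤ λ ε 0<ε →
  let N , p = x≃y ε 0<ε in N , λ k N≤k → ∣p-q∣<ε⇒p<q+ε (seq x k) (seq y k) (p k N≤k)

≃-sym : ∀ {x y} → x ≃ y → y ≃ x
≃-sym {x} {y} (mk≃ x≃y) = mk≃ λ ε 0<ε →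
  let N , p = x≃y ε 0<ε in
  N , λ k N≤k → subst (ℚ._< ε) (∣p-q∣≡∣q-p∣ (seq x k) (seq y k)) (p k N≤k)

≃⇒≥ : ∀ {x y} → x ≃ y → y ≤ x
≃⇒≥ x≃y = ≃⇒≤ (≃-sym x≃y)

-- Identities of rational arithmetic transfer term by term, so algebraic laws of the reals involve
-- no estimates.
pointwise⇒≃ : ∀ {x y} → (∀ k → seq x k ≡ seq y k) → x ≃ y
pointwise⇒≃ x≡y = ≤-antisym (pointwise⇒≤ (ℚ.≤-reflexive ∘ x≡y))
                            (pointwise⇒≤ (ℚ.≤-reflexive ∘ ≡.sym ∘ x≡y))

≃-refl : ∀ {x} → x ≃ x
≃-refl = pointwise⇒≃ λ _ → refl

≃-trans : ∀ {x y z} → x ≃ y → y ≃ z → x ≃ z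
≃-trans p q = ≤-antisym (≤-trans (≃⇒≤ p) (≃⇒≤ q)) (≤-trans (≃⇒≥ q) (≃⇒≥ p))

+-cong : ∀ {x y u v} → x ≃ y → u ≃ v → x + u ≃ y + v
+-cong p q = ≤-antisym (+-mono-≤ (≃⇒≤ p) (≃⇒≤ q)) (+-mono-≤ (≃⇒≥ p) (≃⇒≥ q))

+-0-commutativeMonoid : CommutativeMonoid _ _
+-0-commutativeMonoid = record
  { Carrier = ℝ ; _≈_ = _≃_ ; _∙_ = _+_ ; ε = 0ℝ
  ; isCommutativeMonoid = record
    { isMonoid = record
      { isSemigroup = record
        { isMagma = record
          { isEquivalence = record { refl = ≃-refl ; sym = ≃-sym ; trans = ≃-trans }
          ; ∙-cong = +-cong }
        ; assoc = λ x y z → pointwise⇒≃ λ k → ℚ.+-assoc (seq x k) (seq y k) (seq z k) }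
      ; identity = (λ x → pointwise⇒≃ λ k → ℚ.+-identityˡ (seq x k))
                 , (λ x → pointwise⇒≃ λ k → ℚ.+-identityʳ (seq x k)) }
    ; comm = λ x y → pointwise⇒≃ λ k → ℚ.+-comm (seq x k) (seq y k) } }

half+half : ∀ x → half x + half x ≃ x
half+half x = pointwise⇒≃ λ k →
  solve 1 (λ a → con ½ :* a :+ con ½ :* a := a) refl (seq x k)

half-mono-≤ : ∀ {x y} → x ≤ y → half x ≤ half y
half-mono-≤ {x} {y} (mk≤ x≤y) = mk≤ λ ε 0<ε →
  let N , p = x≤y (ε ℚ.+ ε) (ℚ.+-mono-< 0<ε 0<ε) in
  N , λ k N≤k → subst (½ ℚ.* seq x k ℚ.<_) (½*[p+2ε]≡½*p+ε (seq y k) ε)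
    (ℚ.*-monoʳ-<-pos ½ (p k N≤k))

half-cong : ∀ {x y} → x ≃ y → half x ≃ half y
half-cong {x} {y} x≃y = ≤-antisym (half-mono-≤ {x} {y} (≃⇒≤ x≃y)) (half-mono-≤ {y} {x} (≃⇒≥ x≃y))

half-+ : ∀ x y → half (x + y) ≃ half x + half y
half-+ x y = pointwise⇒≃ λ k → ℚ.*-distribˡ-+ ½ (seq x k) (seq y k)

half-0 : half 0ℝ ≃ 0ℝ
half-0 = pointwise⇒≃ λ _ → refl

half-nonNeg : ∀ {x} → 0ℝ ≤ x → 0ℝ ≤ half x
half-nonNeg {x} 0≤x = ≤-trans {0ℝ} {half 0ℝ} {half x} (≃⇒≥ half-0) (half-mono-≤ 0≤x)

-- Nonnegative reals

-- Without η and with abstract operations, the type checker never compares the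
-- Cauchy and nonnegativity proofs inside two elements, which is very slow.
record ℝ≥0 : Set where
  no-eta-equality
  pattern
  constructor mkℝ≥0
  field
    value  : ℝ
    nonNeg : 0ℝ ≤ value

open ℝ≥0

+-nonNeg : ∀ {x y} → 0ℝ ≤ x → 0ℝ ≤ y → 0ℝ ≤ x + y
+-nonNeg {x} {y} 0≤x 0≤y = ≤-trans {0ℝ} {0ℝ + 0ℝ} {x + y}
  (pointwise⇒≤ λ _ → ℚ.≤-refl) (+-mono-≤ {0ℝ} {x} {0ℝ} {y} 0≤x 0≤y)

infix  4 _≃₊_
infixl 6 _+₊_

_≃₊_ : ℝ≥0 → ℝ≥0 → Set
x ≃₊ y = value x ≃ value y

abstract
  _+₊_ : ℝ≥0 → ℝ≥0 → ℝ≥0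
  x +₊ y = mkℝ≥0 (value x + value y) (+-nonNeg {value x} {value y} (nonNeg x) (nonNeg y))

  0₊ : ℝ≥0
  0₊ = mkℝ≥0 0ℝ (pointwise⇒≤ λ _ → ℚ.≤-refl)

  half₊ : ∀ {x} → 0ℝ ≤ x → ℝ≥0
  half₊ {x} 0≤x = mkℝ≥0 (half x) (half-nonNeg {x} 0≤x)

  mkℝ≥0-+₊ : ∀ x y (0≤x : 0ℝ ≤ x) (0≤y : 0ℝ ≤ y) → value (mkℝ≥0 x 0≤x +₊ mkℝ≥0 y 0≤y) ≃ x + y
  mkℝ≥0-+₊ x y _ _ = ≃-refl {x + y}

  value-+₊ : ∀ x y → value (x +₊ y) ≃ value x + value y
  value-+₊ x y = ≃-refl {value x + value y}

  value-0₊ : value 0₊ ≃ 0ℝ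
  value-0₊ = ≃-refl {0ℝ}

  value-half₊ : ∀ {x} (0≤x : 0ℝ ≤ x) → value (half₊ {x} 0≤x) ≃ half x
  value-half₊ {x} _ = ≃-refl {half x}

  -- Repackaging with mk≃ ∘ close makes the checker compare sequences only.
  half₊+half₊ : ∀ {x} (0≤x : 0ℝ ≤ x) → value (half₊ {x} 0≤x +₊ half₊ {x} 0≤x) ≃ x
  half₊+half₊ {x} _ = mk≃ (close (half+half x))

  half₊-cong : ∀ {x y} (0≤x : 0ℝ ≤ x) (0≤y : 0ℝ ≤ y) → x ≃ y → half₊ {x} 0≤x ≃₊ half₊ {y} 0≤y
  half₊-cong {x} {y} _ _ x≃y = mk≃ (close (half-cong {x} {y} x≃y))

  +₊-cong : ∀ {x y u v} → x ≃₊ y → u ≃₊ v → x +₊ u ≃₊ y +₊ v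
  +₊-cong {x} {y} {u} {v} = +-cong {value x} {value y} {value u} {value v}

  +₊-assoc : ∀ x y z → (x +₊ y) +₊ z ≃₊ x +₊ (y +₊ z)
  +₊-assoc x y z = pointwise⇒≃ λ k → ℚ.+-assoc (seq (value x) k) (seq (value y) k) (seq (value z) k)

  +₊-identityˡ : ∀ x → 0₊ +₊ x ≃₊ x
  +₊-identityˡ x = pointwise⇒≃ λ k → ℚ.+-identityˡ (seq (value x) k)

  +₊-identityʳ : ∀ x → x +₊ 0₊ ≃₊ x
  +₊-identityʳ x = pointwise⇒≃ λ k → ℚ.+-identityʳ (seq (value x) k)

  +₊-comm : ∀ x y → x +₊ y ≃₊ y +₊ x
  +₊-comm x y = pointwise⇒≃ λ k → ℚ.+-comm (seq (value x) k) (seq (value y) k)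

+₊-0₊-commutativeMonoid : CommutativeMonoid _ _
+₊-0₊-commutativeMonoid = record
  { Carrier = ℝ≥0 ; _≈_ = _≃₊_ ; _∙_ = _+₊_ ; ε = 0₊
  ; isCommutativeMonoid = record
    { isMonoid = record
      { isSemigroup = record
        { isMagma = record
          { isEquivalence = record
            { refl  = λ {x} → ≃-refl {value x}
            ; sym   = λ {x} {y} → ≃-sym {value x} {value y}
            ; trans = λ {x} {y} {z} → ≃-trans {value x} {value y} {value z} }
          ; ∙-cong = λ {x} {y} {u} {v} → +₊-cong {x} {y} {u} {v} }
        ; assoc = +₊-assoc }
      ; identity = +₊-identityˡ , +₊-identityʳ }
    ; comm = +₊-comm } }

-- Refinement of nonnegative reals by minima

module ℝ≥0-Refinement = Refinement +₊-0₊-commutativeMonoid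

-- Depending on whether `p` or `r` is the minimum, the right side is one of the two terms on the
-- left. Rationals permit this case distinction, so it is made term by term.
[p+[q-r]]⊓q≤q-[r-p⊓r] : ∀ p q r → (p ℚ.+ (q ℚ.- r)) ℚ.⊓ q ℚ.≤ q ℚ.- (r ℚ.- p ℚ.⊓ r)
[p+[q-r]]⊓q≤q-[r-p⊓r] p q r = [ left , right ]′ (ℚ.⊓-sel p r)
  where
  Bound : ℚ → Set
  Bound s = (p ℚ.+ (q ℚ.- r)) ℚ.⊓ q ℚ.≤ q ℚ.- (r ℚ.- s)

  left : p ℚ.⊓ r ≡ p → Bound (p ℚ.⊓ r)
  left eq = subst Bound (≡.sym eq) (subst ((p ℚ.+ (q ℚ.- r)) ℚ.⊓ q ℚ.≤_)
    (solve 3 (λ p q r → p :+ (q :- r) := q :- (r :- p)) refl p q r)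
    (ℚ.p⊓q≤p (p ℚ.+ (q ℚ.- r)) q))

  right : p ℚ.⊓ r ≡ r → Bound (p ℚ.⊓ r)
  right eq = subst Bound (≡.sym eq) (subst ((p ℚ.+ (q ℚ.- r)) ℚ.⊓ q ℚ.≤_)
    (solve 2 (λ q r → q := q :- (r :- r)) refl q r)
    (ℚ.p⊓q≤q (p ℚ.+ (q ℚ.- r)) q))

p≤q⇒0≤q-p : ∀ {p q} → p ℚ.≤ q → 0ℚ ℚ.≤ q ℚ.- p
p≤q⇒0≤q-p {p} {q} p≤q = subst (ℚ._≤ q ℚ.- p) (ℚ.+-inverseʳ p) (ℚ.+-monoˡ-≤ (ℚ.- p) p≤q)

-- Once the corner is the minimum of `a` and `c`, the first row, the first column and the second row
-- force `y`, `z` and `w`, and these three equations hold termwise. The equality of totals enters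
-- only in `col₂`.
module RefineByMinimum (a b c d : ℝ) (a+b≃c+d : a + b ≃ c + d) where
  x y z w : ℝ
  x = a ⊓ c
  y = a + neg x
  z = c + neg x
  w = b + neg z

  row₁ : x + y ≃ a
  row₁ = pointwise⇒≃ λ k → solve 2 (λ x a → x :+ (a :- x) := a) refl (seq x k) (seq a k)

  row₂ : z + w ≃ b
  row₂ = pointwise⇒≃ λ k → solve 2 (λ z b → z :+ (b :- z) := b) refl (seq z k) (seq b k)

  col₁ : x + z ≃ c
  col₁ = pointwise⇒≃ λ k → solve 2 (λ x c → x :+ (c :- x) := c) refl (seq x k) (seq c k)

  a+[b-c]≃d : a + (b + neg c) ≃ d
  a+[b-c]≃d = ≃-trans {a + (b + neg c)} {(c + d) + neg c} {d}
    (≃-trans {a + (b + neg c)} {(a + b) + neg c} {(c + d) + neg c}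
      (pointwise⇒≃ λ k → ≡.sym (ℚ.+-assoc (seq a k) (seq b k) (seq (neg c) k)))
      (+-cong {a + b} {c + d} {neg c} {neg c} a+b≃c+d (≃-refl {neg c})))
    (pointwise⇒≃ λ k → solve 2 (λ c d → c :+ d :- c := d) refl (seq c k) (seq d k))

  col₂ : y + w ≃ d
  col₂ = ≃-trans {y + w} {a + (b + neg c)} {d} (pointwise⇒≃ λ k →
    solve 4 (λ a b c x → (a :- x) :+ (b :- (c :- x)) := a :+ (b :- c))
      refl (seq a k) (seq b k) (seq c k) (seq x k)) a+[b-c]≃d

  0≤y : 0ℝ ≤ y
  0≤y = pointwise⇒≤ λ k → p≤q⇒0≤q-p (ℚ.p⊓q≤p (seq a k) (seq c k))

  0≤z : 0ℝ ≤ z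
  0≤z = pointwise⇒≤ λ k → p≤q⇒0≤q-p (ℚ.p⊓q≤q (seq a k) (seq c k))

  -- `w` is at least the minimum of `d` and `b`. For the termwise estimate `d` is written as
  -- `a + (b + neg c)`, a sequence that agrees with `d` only in the limit.
  0≤w : 0ℝ ≤ b → 0ℝ ≤ d → 0ℝ ≤ w
  0≤w 0≤b 0≤d = ≤-trans {0ℝ} {(a + (b + neg c)) ⊓ b} {w}
    (⊓-glb {a + (b + neg c)} {b} {0ℝ}
      (≤-trans {0ℝ} {d} {a + (b + neg c)} 0≤d (≃⇒≥ {a + (b + neg c)} {d} a+[b-c]≃d)) 0≤b)
    (pointwise⇒≤ λ k → [p+[q-r]]⊓q≤q-[r-p⊓r] (seq a k) (seq b k) (seq c k))

ℝ≥0-refine : ∀ {a b c d : ℝ≥0} → a +₊ b ≃₊ c +₊ d → ℝ≥0-Refinement._,_Refines_,_ a b c d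
ℝ≥0-refine {mkℝ≥0 a 0≤a} {mkℝ≥0 b 0≤b} {mkℝ≥0 c 0≤c} {mkℝ≥0 d 0≤d} a+b≃c+d = record
  { x = mkℝ≥0 x 0≤x ; y = mkℝ≥0 y 0≤y
  ; z = mkℝ≥0 z 0≤z ; w = mkℝ≥0 w (0≤w 0≤b 0≤d)
  ; row₁ = margin x y 0≤x 0≤y row₁
  ; row₂ = margin z w 0≤z (0≤w 0≤b 0≤d) row₂
  ; col₁ = margin x z 0≤x 0≤z col₁
  ; col₂ = margin y w 0≤y (0≤w 0≤b 0≤d) col₂
  }
  where
  sums≃ : a + b ≃ c + d
  sums≃ = ≃-trans {a + b} {value (mkℝ≥0 a 0≤a +₊ mkℝ≥0 b 0≤b)} {c + d}
    (≃-sym {value (mkℝ≥0 a 0≤a +₊ mkℝ≥0 b 0≤b)} {a + b} (mkℝ≥0-+₊ a b 0≤a 0≤b))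
    (≃-trans {value (mkℝ≥0 a 0≤a +₊ mkℝ≥0 b 0≤b)} {value (mkℝ≥0 c 0≤c +₊ mkℝ≥0 d 0≤d)} {c + d}
      a+b≃c+d (mkℝ≥0-+₊ c d 0≤c 0≤d))

  open RefineByMinimum a b c d sums≃

  0≤x : 0ℝ ≤ x
  0≤x = ⊓-glb {a} {c} {0ℝ} 0≤a 0≤c

  margin : ∀ {s} u v (0≤u : 0ℝ ≤ u) (0≤v : 0ℝ ≤ v) →
    u + v ≃ s → value (mkℝ≥0 u 0≤u +₊ mkℝ≥0 v 0≤v) ≃ s
  margin {s} u v 0≤u 0≤v =
    ≃-trans {value (mkℝ≥0 u 0≤u +₊ mkℝ≥0 v 0≤v)} {u + v} {s} (mkℝ≥0-+₊ u v 0≤u 0≤v)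

-- Rationals, integers and naturals among the reals

fromℚ-cancel-≤ : ∀ {p q} → fromℚ p ≤ fromℚ q → p ℚ.≤ q
fromℚ-cancel-≤ {p} {q} (mk≤ p≤q) = ℚ.≮⇒≥ λ q<p →
  -- With slack `p - q` the bound for these constant sequences reads `p < p`.
  let N , h = p≤q (p ℚ.- q) (subst (ℚ._< p ℚ.- q) (ℚ.+-inverseʳ q) (ℚ.+-monoˡ-< (ℚ.- q) q<p)) in
  ℚ.<-irrefl (solve 2 (λ p q → p := q :+ (p :- q)) refl p q) (h N ℕ.≤-refl)

fromℚ-injective : ∀ {p q} → fromℚ p ≃ fromℚ q → p ≡ q
fromℚ-injective p≃q = ℚ.≤-antisym (fromℚ-cancel-≤ (≃⇒≤ p≃q)) (fromℚ-cancel-≤ (≃⇒≥ p≃q))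

/1-injective : ∀ {i j} → i ℚ./ 1 ≡ j ℚ./ 1 → i ≡ j
/1-injective {i} {j} eq with ℚ./-injective-≃ (ℚᵘ.mkℚᵘ i 0) (ℚᵘ.mkℚᵘ j 0) eq
... | ℚᵘ.*≡* i*1≡j*1 = ≡.trans (≡.sym (ℤ.*-identityʳ i)) (≡.trans i*1≡j*1 (ℤ.*-identityʳ j))

-- Division in `ℚ` normalises by a gcd and does not compute on variables, so the sums are compared
-- as unnormalised fractions with denominator 1.
/1-+ : ∀ i j → (i ℤ.+ j) ℚ./ 1 ≡ i ℚ./ 1 ℚ.+ j ℚ./ 1
/1-+ i j = ℚ.toℚᵘ-injective (begin-equality
  ℚ.toℚᵘ ((i ℤ.+ j) ℚ./ 1)                  ≃⟨ ℚ.toℚᵘ-fromℚᵘ _ ⟩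
  ℚᵘ.mkℚᵘ (i ℤ.+ j) 0
    ≃⟨ ℚᵘ.*≡* (cong (ℤ._* ℤ.+ 1) (≡.sym (≡.cong₂ ℤ._+_ (ℤ.*-identityʳ i) (ℤ.*-identityʳ j)))) ⟩
  ℚᵘ.mkℚᵘ i 0 ℚᵘ.+ ℚᵘ.mkℚᵘ j 0
    ≃⟨ ℚᵘ.+-cong (ℚ.toℚᵘ-fromℚᵘ (ℚᵘ.mkℚᵘ i 0)) (ℚ.toℚᵘ-fromℚᵘ (ℚᵘ.mkℚᵘ j 0)) ⟨
  ℚ.toℚᵘ (i ℚ./ 1) ℚᵘ.+ ℚ.toℚᵘ (j ℚ./ 1)    ≃⟨ ℚ.toℚᵘ-homo-+ (i ℚ./ 1) (j ℚ./ 1) ⟨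
  ℚ.toℚᵘ (i ℚ./ 1 ℚ.+ j ℚ./ 1)              ∎)
  where open ℚᵘ.≤-Reasoning

fromℕ-+ : ∀ a b → fromℕ (a ℕ.+ b) ≃ fromℕ a + fromℕ b
fromℕ-+ a b = pointwise⇒≃ λ _ → /1-+ (ℤ.+ a) (ℤ.+ b)

fromℕ-injective : ∀ {a b} → fromℕ a ≃ fromℕ b → a ≡ b
fromℕ-injective = ℤ.+-injective ∘ /1-injective ∘ fromℚ-injective

fromℕ-nonNeg : ∀ a → 0ℝ ≤ fromℕ a
fromℕ-nonNeg a = pointwise⇒≤ λ _ → ℚ.nonNegative⁻¹ (ℤ.+ a ℚ./ 1) {{ℚ.normalize-nonNeg a 1}}

nonNeg-integer⇒natural : ∀ {x} → 0ℝ ≤ x → IsInteger x → ∃[ a ] x ≃ fromℕ a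
nonNeg-integer⇒natural 0≤x (ℤ.+ a , x≃a) = a , x≃a
nonNeg-integer⇒natural 0≤x (-[1+ a ] , x≃z) = contradiction
  (fromℚ-cancel-≤ (≤-trans 0≤x (≃⇒≤ x≃z)))
  (ℚ.<-irrefl refl ∘ ℚ.<-≤-trans
    (ℚ.neg-antimono-< (ℚ.positive⁻¹ (ℤ.+ suc a ℚ./ 1) {{ℚ.normalize-pos (suc a) 1}})))

-- Transfer to real and integer matrices

open ℕ-Parity using (parity-necessary; parity-sufficient)
open CommutativeMonoid +-0-commutativeMonoid using (setoid) renaming (monoid to +-0-monoid)
open CommutativeMonoidSum +-0-commutativeMonoid using (sum-cong-≋)
module ≃-Reasoning = SetoidReasoning setoid

-- Columns `j` and `opposite j` of a matrix fixed by `r∞` agree entry by entry, hence so do their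
-- sums.
symmetric⇒palindromic : ∀ {m n} {R : Vector ℝ m} {S : Vector ℝ n} →
  Satisfiable (𝒯∞ R S) → Palindromic S
symmetric⇒palindromic {S = S} (A , (_ , _ , cols) , sym-A) j =
  ≃-trans {S j} {sum (transpose A j)} {S (opposite j)}
    (≃-sym {sum (transpose A j)} {S j} (cols j))
    (≃-trans {sum (transpose A j)} {sum (transpose A (opposite j))} {S (opposite j)}
      (sum-cong-≋ (λ i → ≃-sym {A i (opposite j)} {A i j} (sym-A i j))) (cols (opposite j)))

sum₊ : ∀ {n} → Vector ℝ≥0 n → ℝ≥0
sum₊ = RawMonoidSum.sum (CommutativeMonoid.rawMonoid +₊-0₊-commutativeMonoid)

sum-value : ∀ {n} (v : Vector ℝ≥0 n) → value (sum₊ v) ≃ sum (λ i → value (v i))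
sum-value = sum-homo (CommutativeMonoid.rawMonoid +₊-0₊-commutativeMonoid) +-0-monoid value
  value-0₊ value-+₊

sum-half : ∀ {n} (v : Vector ℝ n) → half (sum v) ≃ sum (λ i → half (v i))
sum-half = sum-homo +-0-rawMonoid +-0-monoid half half-0 half-+

sumℕ : ∀ {n} → Vector ℕ n → ℕ
sumℕ = RawMonoidSum.sum ℕ.+-0-rawMonoid

sum-fromℕ : ∀ {n} (v : Vector ℕ n) → fromℕ (sumℕ v) ≃ sum (λ i → fromℕ (v i))
sum-fromℕ = sum-homo ℕ.+-0-rawMonoid +-0-monoid fromℕ (≃-refl {0ℝ}) fromℕ-+

sum-half₊ : ∀ {n} (v : Vector ℝ n) (0≤v : ∀ i → 0ℝ ≤ v i) →
  value (sum₊ (λ i → half₊ {v i} (0≤v i))) ≃ half (sum v)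
sum-half₊ v 0≤v = begin
  value (sum₊ (λ i → half₊ {v i} (0≤v i)))      ≈⟨ sum-value (λ i → half₊ {v i} (0≤v i)) ⟩
  sum (λ i → value (half₊ {v i} (0≤v i)))       ≈⟨ sum-cong-≋ (λ i → value-half₊ {v i} (0≤v i)) ⟩
  sum (λ i → half (v i))                        ≈⟨ sum-half v ⟨
  half (sum v)                                  ∎
  where open ≃-Reasoning

-- `Q` and `T` halve the margins. Doubling restores `R`, and palindromicity turns
-- `T j +₊ T (opposite j)` into a doubling too, which restores `S`.
palindromic⇒symmetric : ∀ {m n} .{{_ : NonZero m}} .{{_ : NonZero n}}
  (R : Vector ℝ m) (S : Vector ℝ n) →
  (∀ i → 0ℝ ≤ R i) → (∀ j → 0ℝ ≤ S j) → sum R ≃ sum S → Palindromic S → Satisfiable (𝒯∞ R S)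
palindromic⇒symmetric R S 0≤R 0≤S ΣR≃ΣS pal =
  let A , sym-A , rows , cols = ℝ≥0-Refinement.symmetric-transport ℝ≥0-refine Q T ΣQ≃ΣT in
  (λ i j → value (A i j)) ,
  ((λ i j → nonNeg (A i j)) ,
   (λ i → begin
     sum (λ j → value (A i j))    ≈⟨ sum-value (A i) ⟨
     value (sum₊ (A i))           ≈⟨ rows i ⟩
     value (Q i +₊ Q i)           ≈⟨ half₊+half₊ {R i} (0≤R i) ⟩
     R i                          ∎) ,
   (λ j → begin
     sum (λ i → value (A i j))                ≈⟨ sum-value (λ i → A i j) ⟨
     value (sum₊ (λ i → A i j))               ≈⟨ cols j ⟩
     value (T j +₊ T (opposite j))            ≈⟨ T-pal j ⟩
     value (T j +₊ T j)                       ≈⟨ half₊+half₊ {S j} (0≤S j) ⟩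
     S j                                      ∎)) ,
  sym-A
  where
  open ≃-Reasoning
  Q = λ i → half₊ {R i} (0≤R i)
  T = λ j → half₊ {S j} (0≤S j)

  T-pal : ∀ j → T j +₊ T (opposite j) ≃₊ T j +₊ T j
  T-pal j = CommutativeMonoid.∙-congˡ +₊-0₊-commutativeMonoid {T j} {T (opposite j)} {T j}
    (half₊-cong {S (opposite j)} {S j} (0≤S (opposite j)) (0≤S j)
      (≃-sym {S j} {S (opposite j)} (pal j)))

  ΣQ≃ΣT : sum₊ Q ≃₊ sum₊ T
  ΣQ≃ΣT = begin
    value (sum₊ Q)    ≈⟨ sum-half₊ R 0≤R ⟩
    half (sum R)      ≈⟨ half-cong {sum R} {sum S} ΣR≃ΣS ⟩
    half (sum S)      ≈⟨ sum-half₊ S 0≤S ⟨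
    value (sum₊ T)    ∎

sum≃fromℕ : ∀ {n} {v : Vector ℝ n} (v′ : Vector ℕ n) → (∀ i → v i ≃ fromℕ (v′ i)) →
  sum v ≃ fromℕ (sumℕ v′)
sum≃fromℕ {v = v} v′ v≃v′ = begin
  sum v                        ≈⟨ sum-cong-≋ v≃v′ ⟩
  sum (λ i → fromℕ (v′ i))     ≈⟨ sum-fromℕ v′ ⟨
  fromℕ (sumℕ v′)              ∎
  where open ≃-Reasoning

-- Brings a margin equation from the reals down to ℕ, by injectivity of `fromℕ`. With `r` itself a
-- sum it does the same for the equality of totals.
natural-margin : ∀ {n r r′} {v : Vector ℝ n} (v′ : Vector ℕ n) → (∀ i → v i ≃ fromℕ (v′ i)) →
  sum v ≃ r → r ≃ fromℕ r′ → sumℕ v′ ≡ r′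
natural-margin {r = r} {r′} {v} v′ v≃v′ Σv≃r r≃r′ = fromℕ-injective (begin
  fromℕ (sumℕ v′)  ≈⟨ sum≃fromℕ {v = v} v′ v≃v′ ⟨
  sum v            ≈⟨ Σv≃r ⟩
  r                ≈⟨ r≃r′ ⟩
  fromℕ r′         ∎)
  where open ≃-Reasoning

-- Parity is a notion for naturals, so integer margins are accompanied by natural vectors that
-- represent them up to `≃`.
module _ {m n} .{{_ : NonZero m}} .{{_ : NonZero n}} (R : Vector ℝ m) (S : Vector ℝ n)
  (ΣR≃ΣS : sum R ≃ sum S) (R′ : Vector ℕ m) (S′ : Vector ℕ n)
  (R≃R′ : ∀ i → R i ≃ fromℕ (R′ i)) (S≃S′ : ∀ j → S j ≃ fromℕ (S′ j)) where

  open ≃-Reasoning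

  symmetric-integer⇒parity : Satisfiable (𝒯∞ℤ R S) → ParityCondition R′ S′
  symmetric-integer⇒parity (A , ((0≤A , rows , cols) , sym-A) , integer) =
    parity-necessary {R = R′} {S′} {A′}
      ( (λ i j → fromℕ-injective (begin
          fromℕ (A′ i (opposite j))  ≈⟨ A≃A′ i (opposite j) ⟨
          A i (opposite j)           ≈⟨ sym-A i j ⟩
          A i j                      ≈⟨ A≃A′ i j ⟩
          fromℕ (A′ i j)             ∎))
      , (λ i → natural-margin {r = R i} {R′ i} {A i} (A′ i) (A≃A′ i) (rows i) (R≃R′ i))
      , (λ j → natural-margin {r = S j} {S′ j} {transpose A j} (transpose A′ j)
          (λ i → A≃A′ i j) (cols j) (S≃S′ j)))
    where
    -- Entries are integers only up to `≃`; nonnegativity allows a natural representative to be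
    -- chosen for each, and these form the matrix `A′`.
    natural : ∀ i j → ∃[ a ] A i j ≃ fromℕ a
    natural i j = nonNeg-integer⇒natural {A i j} (0≤A i j) (integer i j)

    A′ = λ i j → proj₁ (natural i j)
    A≃A′ = λ i j → proj₂ (natural i j)

  parity⇒symmetric-integer : Palindromic S → ParityCondition R′ S′ → Satisfiable (𝒯∞ℤ R S)
  parity⇒symmetric-integer pal parity =
    let A , sym-A , rows , cols = parity-sufficient R′ S′ ΣR′≡ΣS′ pal′ parity in
    (λ i j → fromℕ (A i j)) ,
    (((λ i j → fromℕ-nonNeg (A i j)) ,
      (λ i → begin
        sum (λ j → fromℕ (A i j))   ≈⟨ sum-fromℕ (A i) ⟨
        fromℕ (sumℕ (A i))          ≡⟨ cong fromℕ (rows i) ⟩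
        fromℕ (R′ i)                ≈⟨ R≃R′ i ⟨
        R i                         ∎) ,
      (λ j → begin
        sum (λ i → fromℕ (A i j))     ≈⟨ sum-fromℕ (λ i → A i j) ⟨
        fromℕ (sumℕ (λ i → A i j))    ≡⟨ cong fromℕ (cols j) ⟩
        fromℕ (S′ j)                  ≈⟨ S≃S′ j ⟨
        S j                           ∎)) ,
     λ i j → begin
        fromℕ (A i (opposite j))   ≡⟨ cong fromℕ (sym-A i j) ⟩
        fromℕ (A i j)              ∎) ,
    λ i j → ℤ.+ A i j , ≃-refl {fromℕ (A i j)}
    where
    ΣR′≡ΣS′ : sumℕ R′ ≡ sumℕ S′
    ΣR′≡ΣS′ = natural-margin {r = sum S} {v = R} R′ R≃R′ ΣR≃ΣS (sum≃fromℕ {v = S} S′ S≃S′)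

    pal′ : ∀ j → S′ (opposite j) ≡ S′ j
    pal′ j = fromℕ-injective (begin
      fromℕ (S′ (opposite j))  ≈⟨ S≃S′ (opposite j) ⟨
      S (opposite j)           ≈⟨ pal j ⟨
      S j                      ≈⟨ S≃S′ j ⟩
      fromℕ (S′ j)             ∎)

theorem9 : ∀ (m n : ℕ) → .{{_ : NonZero m}} → .{{_ : NonZero n}} →
    (R : Vector ℝ m) (S : Vector ℝ n) →
    (∀ i → 0ℝ ≤ R i) → (∀ j → 0ℝ ≤ S j) → sum R ≃ sum S →
    (Satisfiable (𝒯∞ R S) ⇔ Palindromic S)
    ×
    ((R′ : Vector ℕ m) (S′ : Vector ℕ n) →
    (∀ i → R i ≃ fromℕ (R′ i)) → (∀ j → S j ≃ fromℕ (S′ j)) →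
    Satisfiable (𝒯∞ℤ R S) ⇔ (Palindromic S × ParityCondition R′ S′))
theorem9 m n R S 0≤R 0≤S ΣR≃ΣS =
  mk⇔ symmetric⇒palindromic (palindromic⇒symmetric R S 0≤R 0≤S ΣR≃ΣS) ,
  λ R′ S′ R≃R′ S≃S′ → mk⇔
    (λ (A , sym-A , integer) → symmetric⇒palindromic (A , sym-A) ,
      symmetric-integer⇒parity R S ΣR≃ΣS R′ S′ R≃R′ S≃S′ (A , sym-A , integer))
    (λ (pal , parity) → parity⇒symmetric-integer R S ΣR≃ΣS R′ S′ R≃R′ S≃S′ pal parity)
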